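{- Let $n\ge 1$ be an integer. Then: (i) $(6n-5) \sigma(n) \equiv \sigma_3(n) \pmod{24}$ if $\gcd(n,6)=1$; (ii) $\sigma(n)+2n\sigma_3(n) \equiv 3 \sigma_5(n) \pmod{16}$ if $2\nmid n$; (iii) $n\sigma(n)+5n\sigma_7(n) \equiv 6n^2\sigma_5(n) \pmod{2^3\cdot 3^2\cdot 7}$ if $\gcd(n, 42)=1$; (iv) $20 \sigma_7(n)+11\sigma_9(n) \equiv \sigma(n)+30n\sigma_7(n) \pmod{2^5\cdot 3\cdot5}$ (for all $n$); (v) $5 \sigma(n)+6n\sigma_7(n) \equiv 11\sigma_9(n) \pmod{2^5}$ if $2\nmid n$; (vi) $\sigma(n)+2n\sigma_3(n) \equiv 3\sigma_5(n) \pmod{2^4\cdot5}$ if $\gcd(n,10)=1$; (vii) $\sigma(n)+10(3n-2)\sigma_7(n) \equiv 11\sigma_9(n) \pmod{2^3\cdot3\cdot5}$ if $\gcd(n, 30)=1$.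
   Context: For $k\ge 1$, $\sigma_k(n)=\sum_{d\mid n} d^k$ (sum over positive divisors of $n$), and $\sigma(n)=\sigma_1(n)$. -}

module Defs where

open import Data.Integer using (ℤ; _-_)
open import Data.Integer.Divisibility using () renaming (_∣_ to _∣ℤ_)
open import Data.List using (List; filter; map; upTo)
open import Data.Nat using (ℕ; suc; _^_)
open import Data.Nat.Divisibility using (_∣?_)
open import Data.Nat.ListAction using (sum)

-- The candidates are 1, …, n, so this is complete exactly when n ≥ 1;
-- divisors 0 is [], although every number divides 0.
divisors : ℕ → List ℕ
divisors n = filter (_∣? n) (map suc (upTo n))

σ[_] : ℕ → ℕ → ℕ
σ[ k ] n = sum (map (_^ k) (divisors n))

σ : ℕ → ℕ
σ = σ[ 1 ]

-- Congruence is taken over ℤ so that _-_ is genuine subtraction,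
-- not truncated.
infix 4 _≡_[mod_]

_≡_[mod_] : ℤ → ℤ → ℤ → Set
a ≡ b [mod m ] = m ∣ℤ (a - b)

{-# OPTIONS --safe #-}
module Submission where

-- Each congruence asks that ∑_{d∣n} f(d) vanish modulo m, where f is a polynomial in d
-- and n.  Writing n = d e, it suffices that f(d) + f(e) ≡ 0, and f(d) ≡ 0 when d = e;
-- modulo a prime power this depends only on the residues of d and e and is checked on
-- all of them.  Only (iv) modulo 32 for even n escapes this termwise argument: there the
-- sum is first reduced to one over the divisors of the odd part of n.

open import Defs
open import Data.Bool using (if_then_else_; true; false)
open import Data.Empty using (⊥)
open import Data.Empty using (⊥)
open import Data.Fin using (Fin; toℕ; fromℕ<)
open import Data.Fin.Properties using (all?; toℕ-fromℕ<)
open import Data.Integer using (ℤ; 0ℤ; +_; _+_; _-_; _*_; _^_; -_; ∣_∣)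
open import Data.Integer.Divisibility.Signed
  using (_∣_; _∣?_; divides; ∣⇒∣ᵤ; ∣m∣n⇒∣m+n; ∣n⇒∣m*n; ∣m⇒∣m*n; *-monoʳ-∣)
import Data.Integer.Properties as ℤ
open import Data.Integer.Tactic.RingSolver using (solve-∀)
open import Data.List using (List; []; _∷_; filter; map; applyUpTo)
open import Data.List.Properties using (map-upTo)
import Data.Nat as ℕ
open import Data.Nat using (ℕ; zero; suc; _≥_; _<_; NonZero; _%_)
open import Data.Nat.Coprimality using (Coprime; coprime-divisor)
import Data.Nat.Divisibility as ℕ
open import Data.Nat.Divisibility using (_∤_)
open import Data.Nat.DivMod using (m≡m%n+[m/n]*n; m%n<n)
open import Data.Nat.GCD using (gcd; gcd-greatest)
open import Data.Nat.Induction using (<-wellFounded)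
open import Data.Nat.LCM using (lcm-least)
open import Data.Nat.ListAction using (sum)
import Data.Nat.Properties as ℕ
open import Data.Product using (_×_; _,_; ∃₂)
open import Function using (_∘_)
open import Induction.WellFounded using (Acc; acc)
open import Level using (0ℓ)
open import Relation.Binary.PropositionalEquality
  using (_≡_; _≢_; refl; sym; trans; cong; cong₂; subst; module ≡-Reasoning)
open import Relation.Nullary using (Dec; yes; no; does; ¬?; _×-dec_; _→-dec_; contradiction)
open import Relation.Nullary.Decidable using (True; toWitness; from-yes; dec-true; dec-false)
open import Relation.Unary using (Pred; Decidable)
open import Relation.Unary.Properties using (U?)

-- Finite sums of integers.

∑ : ℕ → (ℕ → ℤ) → ℤ
∑ zero    f = 0ℤ
∑ (suc N) f = f 0 + ∑ N (f ∘ suc)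

∑-cong : ∀ N {f g} → (∀ i → f i ≡ g i) → ∑ N f ≡ ∑ N g
∑-cong zero    f≗g = refl
∑-cong (suc N) f≗g = cong₂ _+_ (f≗g 0) (∑-cong N (f≗g ∘ suc))

∑-zero : ∀ N {f} → (∀ i → f i ≡ 0ℤ) → ∑ N f ≡ 0ℤ
∑-zero zero    f≗0 = refl
∑-zero (suc N) f≗0 = cong₂ _+_ (f≗0 0) (∑-zero N (f≗0 ∘ suc))

∑-distrib-+ : ∀ N f g → ∑ N (λ i → f i + g i) ≡ ∑ N f + ∑ N g
∑-distrib-+ zero    f g = refl
∑-distrib-+ (suc N) f g =
  trans (cong (λ s → f 0 + g 0 + s) (∑-distrib-+ N (f ∘ suc) (g ∘ suc)))
        (interchange (f 0) (g 0) _ _)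
  where
  interchange : ∀ a b c d → a + b + (c + d) ≡ a + c + (b + d)
  interchange = solve-∀

*-distribˡ-∑ : ∀ N c f → ∑ N (λ i → c * f i) ≡ c * ∑ N f
*-distribˡ-∑ zero    c f = sym (ℤ.*-zeroʳ c)
*-distribˡ-∑ (suc N) c f =
  trans (cong (λ s → c * f 0 + s) (*-distribˡ-∑ N c (f ∘ suc)))
        (sym (ℤ.*-distribˡ-+ c (f 0) _))

∑-++ : ∀ M N f → ∑ (M ℕ.+ N) f ≡ ∑ M f + ∑ N (f ∘ (M ℕ.+_))
∑-++ zero    N f = sym (ℤ.+-identityˡ _)
∑-++ (suc M) N f =
  trans (cong (λ s → f 0 + s) (∑-++ M N (f ∘ suc))) (sym (ℤ.+-assoc (f 0) _ _))

∑-parity : ∀ N f → ∑ (N ℕ.* 2) f ≡ ∑ N (λ i → f (i ℕ.* 2)) + ∑ N (λ i → f (suc (i ℕ.* 2)))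
∑-parity zero    f = refl
∑-parity (suc N) f =
  trans (cong (λ s → f 0 + (f 1 + s)) (∑-parity N (f ∘ suc ∘ suc)))
        (interchange (f 0) (f 1) _ _)
  where
  interchange : ∀ a b c d → a + (b + (c + d)) ≡ a + c + (b + d)
  interchange = solve-∀

∑-single : ∀ {N} q {f} → q < N → (∀ i → i ≢ q → f i ≡ 0ℤ) → ∑ N f ≡ f q
∑-single {suc N} zero    {f} q<N f≗0 =
  trans (cong (λ s → f 0 + s) (∑-zero N (λ i → f≗0 (suc i) λ ()))) (ℤ.+-identityʳ _)
∑-single {suc N} (suc q) {f} q<N f≗0 =
  trans (cong₂ _+_ (f≗0 0 λ ())
                   (∑-single q (ℕ.s<s⁻¹ q<N) (λ i i≢q → f≗0 (suc i) (i≢q ∘ ℕ.suc-injective))))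
        (ℤ.+-identityˡ _)

∣∑ : ∀ {m} N {f} → (∀ i → m ∣ f i) → m ∣ ∑ N f
∣∑ zero    m∣f = divides 0ℤ refl
∣∑ (suc N) m∣f = ∣m∣n⇒∣m+n (m∣f 0) (∣∑ N (m∣f ∘ suc))

-- Each off-diagonal entry is grouped with its mirror image, and diagonal entries stand alone: the
-- pair condition at i = j would give only twice `g i i`, too weak for even `m`. The induction peels
-- off the first row and column.
∣∑∑ : ∀ {m} N (g : ℕ → ℕ → ℤ) → (∀ i j → m ∣ g i j + g j i) → (∀ i → m ∣ g i i) →
      m ∣ ∑ N (λ i → ∑ N (g i))
∣∑∑ zero    g m∣pair m∣diag = divides 0ℤ refl
∣∑∑ {m} (suc N) g m∣pair m∣diag =
  subst (m ∣_) (sym split)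
    (∣m∣n⇒∣m+n (∣m∣n⇒∣m+n (m∣diag 0) (∣∑ N (λ i → m∣pair 0 (suc i))))
               (∣∑∑ N (λ i j → g (suc i) (suc j)) (λ i j → m∣pair (suc i) (suc j)) (m∣diag ∘ suc)))
  where
  open ≡-Reasoning
  assoc : ∀ a b c d → a + b + (c + d) ≡ a + (b + c) + d
  assoc = solve-∀
  row col inner : ℤ
  row = ∑ N (λ j → g 0 (suc j))
  col = ∑ N (λ i → g (suc i) 0)
  inner = ∑ N (λ i → ∑ N (λ j → g (suc i) (suc j)))
  split : ∑ (suc N) (λ i → ∑ (suc N) (g i)) ≡
          g 0 0 + ∑ N (λ i → g 0 (suc i) + g (suc i) 0) + inner
  split = begin
    g 0 0 + row + ∑ N (λ i → g (suc i) 0 + ∑ N (λ j → g (suc i) (suc j)))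
      ≡⟨ cong (λ s → g 0 0 + row + s) (∑-distrib-+ N _ _) ⟩
    g 0 0 + row + (col + inner)
      ≡⟨ assoc (g 0 0) row col inner ⟩
    g 0 0 + (row + col) + inner
      ≡⟨ cong (λ s → g 0 0 + s + inner) (∑-distrib-+ N _ _) ⟨
    g 0 0 + ∑ N (λ i → g 0 (suc i) + g (suc i) 0) + inner ∎

-- Divisor sums as indicator sums over an interval.

infix 5 _when_

-- With an indicator in place of a filtered list, divisor sums of different numbers run over a
-- common interval and can be compared term by term.
_when_ : ∀ {P : Set} → ℤ → Dec P → ℤ
x when p? = if does p? then x else 0ℤ

when-yes : ∀ {P : Set} x (p? : Dec P) → P → x when p? ≡ x
when-yes x p? p = cong (if_then x else 0ℤ) (dec-true p? p)

when-no : ∀ {P : Set} x (p? : Dec P) → (P → ⊥) → x when p? ≡ 0ℤ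
when-no x p? ¬p = cong (if_then x else 0ℤ) (dec-false p? ¬p)

when-cong : ∀ {P Q : Set} x (p? : Dec P) (q? : Dec Q) → (P → Q) → (Q → P) → x when p? ≡ x when q?
when-cong x (yes p) q? P→Q Q→P = sym (when-yes x q? (P→Q p))
when-cong x (no ¬p) q? P→Q Q→P = sym (when-no x q? (¬p ∘ Q→P))

when-* : ∀ {P : Set} c x (p? : Dec P) → c * x when p? ≡ c * (x when p?)
when-* c x (yes _) = refl
when-* c x (no _)  = sym (ℤ.*-zeroʳ c)

when-+ : ∀ {P : Set} x y (p? : Dec P) → (x + y when p?) ≡ (x when p?) + (y when p?)
when-+ x y (yes _) = refl
when-+ x y (no _)  = refl

∣when : ∀ {P : Set} {m} x (p? : Dec P) → (P → m ∣ x) → m ∣ (x when p?)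
∣when x (yes p) m∣x = m∣x p
∣when x (no _)  _   = divides 0ℤ refl

pos-^ : ∀ m k → + (m ℕ.^ k) ≡ (+ m) ^ k
pos-^ m zero    = refl
pos-^ m (suc k) = trans (ℤ.pos-* m (m ℕ.^ k)) (cong (+ m *_) (pos-^ m k))

-- A general `f` is carried because the induction replaces `f` by `f ∘ suc`; only `f = suc` is
-- wanted in the end.
sum-filter : ∀ k n (f : ℕ → ℕ) N →
  + sum (map (ℕ._^ k) (filter (ℕ._∣? n) (applyUpTo f N))) ≡ ∑ N (λ i → (+ f i) ^ k when (f i ℕ.∣? n))
sum-filter k n f zero = refl
sum-filter k n f (suc N) with does (f 0 ℕ.∣? n)
... | true  = trans (ℤ.pos-+ (f 0 ℕ.^ k) _) (cong₂ _+_ (pos-^ (f 0) k) (sum-filter k n (f ∘ suc) N))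
... | false = trans (sum-filter k n (f ∘ suc) N) (sym (ℤ.+-identityˡ _))

-- The added index 0 contributes nothing because 0 does not divide a positive number, and neither
-- does any index beyond n. Leaving `N` free lets σₖ(m) and σₖ(2n) share one range later.
σ-∑ : ∀ k {n N} → n ≥ 1 → n < N → + σ[ k ] n ≡ ∑ N (λ d → (+ d) ^ k when (d ℕ.∣? n))
σ-∑ k {n@(suc _)} n≥1 n<N with ℕ.m≤n⇒∃[o]m+o≡n n<N
... | r , refl = begin
  + σ[ k ] n
    ≡⟨ cong (λ ds → + sum (map (ℕ._^ k) (filter (ℕ._∣? n) ds))) (map-upTo suc n) ⟩
  + sum (map (ℕ._^ k) (filter (ℕ._∣? n) (applyUpTo suc n)))
    ≡⟨ sum-filter k n suc n ⟩
  ∑ n (F ∘ suc)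
    ≡⟨ ℤ.+-identityˡ (∑ n (F ∘ suc)) ⟨
  0ℤ + ∑ n (F ∘ suc)
    ≡⟨ cong (_+ ∑ n (F ∘ suc))
         (when-no ((+ 0) ^ k) (0 ℕ.∣? n) (λ 0∣n → contradiction (ℕ.0∣⇒≡0 0∣n) λ ())) ⟨
  ∑ (suc n) F
    ≡⟨ ℤ.+-identityʳ (∑ (suc n) F) ⟨
  ∑ (suc n) F + 0ℤ
    ≡⟨ cong (λ s → ∑ (suc n) F + s) (∑-zero r (λ i →
         when-no ((+ (suc n ℕ.+ i)) ^ k) (suc n ℕ.+ i ℕ.∣? n) (ℕ.>⇒∤ (ℕ.m≤m+n (suc n) i)))) ⟨
  ∑ (suc n) F + ∑ r (F ∘ (suc n ℕ.+_))
    ≡⟨ ∑-++ (suc n) r F ⟨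
  ∑ (suc n ℕ.+ r) F ∎
  where
  open ≡-Reasoning
  F : ℕ → ℤ
  F d = (+ d) ^ k when (d ℕ.∣? n)

-- Linear forms in divisor sums.

-- The list of triples (a , i , k) stands for the expression ∑ a nⁱ σₖ(n).
Form : Set
Form = List (ℤ × ℕ × ℕ)

-- The power sums enter through an arbitrary `s`, in which the value is linear. Hence a form at the
-- divisor sums of n is the sum of its values at the powers of the individual divisors.
⟦_⟧ : Form → ℤ → (ℕ → ℤ) → ℤ
⟦ [] ⟧              ν s = 0ℤ
⟦ (a , i , k) ∷ F ⟧ ν s = a * ν ^ i * s k + ⟦ F ⟧ ν s

⟦_⟧σ : Form → ℕ → ℤ
⟦ F ⟧σ n = ⟦ F ⟧ (+ n) (λ k → + σ[ k ] n)

-- The contribution of the divisor δ of ν.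
⟦_⟧at : Form → ℤ → ℤ → ℤ
⟦ F ⟧at ν δ = ⟦ F ⟧ ν (δ ^_)

⟦⟧-cong : ∀ F ν {s t} → (∀ k → s k ≡ t k) → ⟦ F ⟧ ν s ≡ ⟦ F ⟧ ν t
⟦⟧-cong []                ν s≗t = refl
⟦⟧-cong ((a , i , k) ∷ F) ν s≗t = cong₂ _+_ (cong (a * ν ^ i *_) (s≗t k)) (⟦⟧-cong F ν s≗t)

⟦⟧-when : ∀ {P : Set} F ν s (p? : Dec P) → ⟦ F ⟧ ν (λ k → s k when p?) ≡ ⟦ F ⟧ ν s when p?
⟦⟧-when F ν s (yes _) = refl
⟦⟧-when F ν s (no _)  = zeros F
  where
  zeros : ∀ F → ⟦ F ⟧ ν (λ _ → 0ℤ) ≡ 0ℤ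
  zeros []                = refl
  zeros ((a , i , k) ∷ F) = cong₂ _+_ (ℤ.*-zeroʳ (a * ν ^ i)) (zeros F)

∑-⟦⟧ : ∀ F ν N (s : ℕ → ℕ → ℤ) → ⟦ F ⟧ ν (λ k → ∑ N (s k)) ≡ ∑ N (λ d → ⟦ F ⟧ ν (λ k → s k d))
∑-⟦⟧ []                ν N s = sym (∑-zero N (λ _ → refl))
∑-⟦⟧ ((a , i , k) ∷ F) ν N s = begin
  c * ∑ N (s k) + ⟦ F ⟧ ν (λ k → ∑ N (s k))
    ≡⟨ cong₂ _+_ (sym (*-distribˡ-∑ N c (s k))) (∑-⟦⟧ F ν N s) ⟩
  ∑ N (λ d → c * s k d) + ∑ N (λ d → ⟦ F ⟧ ν (λ k → s k d))
    ≡⟨ ∑-distrib-+ N _ _ ⟨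
  ∑ N (λ d → c * s k d + ⟦ F ⟧ ν (λ k → s k d)) ∎
  where
  open ≡-Reasoning
  c : ℤ
  c = a * ν ^ i

⟦⟧σ-∑ : ∀ F {n} → n ≥ 1 → ⟦ F ⟧σ n ≡ ∑ (suc n) (λ d → ⟦ F ⟧at (+ n) (+ d) when (d ℕ.∣? n))
⟦⟧σ-∑ F {n} n≥1 = begin
  ⟦ F ⟧σ n
    ≡⟨ ⟦⟧-cong F (+ n) (λ k → σ-∑ k n≥1 (ℕ.n<1+n n)) ⟩
  ⟦ F ⟧ (+ n) (λ k → ∑ (suc n) (λ d → (+ d) ^ k when (d ℕ.∣? n)))
    ≡⟨ ∑-⟦⟧ F (+ n) (suc n) (λ k d → (+ d) ^ k when (d ℕ.∣? n)) ⟩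
  ∑ (suc n) (λ d → ⟦ F ⟧ (+ n) (λ k → (+ d) ^ k when (d ℕ.∣? n)))
    ≡⟨ ∑-cong (suc n) (λ d → ⟦⟧-when F (+ n) ((+ d) ^_) (d ℕ.∣? n)) ⟩
  ∑ (suc n) (λ d → ⟦ F ⟧at (+ n) (+ d) when (d ℕ.∣? n)) ∎
  where open ≡-Reasoning

-- Pairing complementary divisors.

-- A divisor of a positive n has exactly one cofactor, itself at most n. This turns a sum over
-- divisors into a sum over the pairs (d, e) with d e = n.
when-divides : ∀ {n} x d → n ≥ 1 → x when (d ℕ.∣? n) ≡ ∑ (suc n) (λ e → x when (d ℕ.* e ℕ.≟ n))
when-divides {n@(suc _)} x d n≥1 with d ℕ.∣? n
... | no d∤n = sym (∑-zero (suc n) (λ e → when-no x (d ℕ.* e ℕ.≟ n)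
    (λ de≡n → d∤n (ℕ.divides e (trans (sym de≡n) (ℕ.*-comm d e))))))
... | yes (ℕ.divides q n≡qd) = sym (trans
    (∑-single q (ℕ.s≤s q≤n) (λ e e≢q → when-no x (d ℕ.* e ℕ.≟ n) (e≢q ∘ unique e)))
    (when-yes x (d ℕ.* q ℕ.≟ n) (sym n≡dq)))
  where
  n≡dq : n ≡ d ℕ.* q
  n≡dq = trans n≡qd (ℕ.*-comm q d)
  q≤n : q ℕ.≤ n
  q≤n = ℕ.∣⇒≤ (ℕ.divides d n≡dq)
  unique : ∀ e → d ℕ.* e ≡ n → e ≡ q
  -- `d` can be cancelled: it is nonzero because d q = n is.
  unique e de≡n = ℕ.*-cancelˡ-≡ e q d {{ℕ.m*n≢0⇒m≢0 d {{subst NonZero n≡dq _}}}} (trans de≡n n≡dq)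

-- The sum becomes a double sum supported on d e = n, a set symmetric under exchanging d and e, so
-- `∣∑∑` applies.
∣⟦⟧σ : ∀ F {m n} → n ≥ 1 →
       (∀ d e → d ℕ.* e ≡ n → m ∣ ⟦ F ⟧at (+ n) (+ d) + ⟦ F ⟧at (+ n) (+ e)) →
       (∀ d → d ℕ.* d ≡ n → m ∣ ⟦ F ⟧at (+ n) (+ d)) →
       m ∣ ⟦ F ⟧σ n
∣⟦⟧σ F {m} {n} n≥1 m∣pair m∣square =
  subst (m ∣_)
    (sym (trans (⟦⟧σ-∑ F n≥1) (∑-cong (suc n) (λ d → when-divides (f d) d n≥1))))
    (∣∑∑ (suc n) (λ d e → f d when (d ℕ.* e ℕ.≟ n)) pair square)
  where
  f : ℕ → ℤ
  f d = ⟦ F ⟧at (+ n) (+ d)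
  square : ∀ d → m ∣ (f d when (d ℕ.* d ℕ.≟ n))
  square d = ∣when (f d) (d ℕ.* d ℕ.≟ n) (m∣square d)
  pair : ∀ d e → m ∣ (f d when (d ℕ.* e ℕ.≟ n)) + (f e when (e ℕ.* d ℕ.≟ n))
  -- After commuting the product, both terms carry the same indicator and merge into one.
  pair d e rewrite ℕ.*-comm e d =
    subst (m ∣_) (when-+ (f d) (f e) (d ℕ.* e ℕ.≟ n)) (∣when (f d + f e) (d ℕ.* e ℕ.≟ n) (m∣pair d e))

-- Congruences between integers.

+-cong-mod : ∀ {m a a′ b b′} → m ∣ a - a′ → m ∣ b - b′ → m ∣ (a + b) - (a′ + b′)
+-cong-mod {m} {a} {a′} {b} {b′} p q = subst (m ∣_) (rearrange a a′ b b′) (∣m∣n⇒∣m+n p q)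
  where
  rearrange : ∀ a a′ b b′ → (a - a′) + (b - b′) ≡ (a + b) - (a′ + b′)
  rearrange = solve-∀

*-cong-mod : ∀ {m a a′ b b′} → m ∣ a - a′ → m ∣ b - b′ → m ∣ a * b - a′ * b′
*-cong-mod {m} {a} {a′} {b} {b′} p q =
  subst (m ∣_) (rearrange a a′ b b′) (∣m∣n⇒∣m+n (∣m⇒∣m*n b p) (∣n⇒∣m*n a′ q))
  where
  rearrange : ∀ a a′ b b′ → (a - a′) * b + a′ * (b - b′) ≡ a * b - a′ * b′
  rearrange = solve-∀

refl-mod : ∀ {m} a → m ∣ a - a
refl-mod a = divides 0ℤ (ℤ.+-inverseʳ a)

^-cong-mod : ∀ {m a a′} k → m ∣ a - a′ → m ∣ a ^ k - a′ ^ k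
^-cong-mod zero    p = refl-mod (+ 1)
^-cong-mod {a = a} {a′} (suc k) p = *-cong-mod {a = a} {a′} p (^-cong-mod k p)

-- The contribution of one divisor is a polynomial in ν and δ with integer coefficients.
⟦⟧at-cong-mod : ∀ {m} F {ν ν′ δ δ′} → m ∣ ν - ν′ → m ∣ δ - δ′ → m ∣ ⟦ F ⟧at ν δ - ⟦ F ⟧at ν′ δ′
⟦⟧at-cong-mod [] p q = refl-mod 0ℤ
⟦⟧at-cong-mod ((a , i , k) ∷ F) {ν} {ν′} {δ} {δ′} p q =
  +-cong-mod {a = a * ν ^ i * δ ^ k} {a * ν′ ^ i * δ′ ^ k}
    (*-cong-mod {a = a * ν ^ i} {a * ν′ ^ i}
      (*-cong-mod {a = a} {a} (refl-mod a) (^-cong-mod i p)) (^-cong-mod k q))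
    (⟦⟧at-cong-mod F p q)

∣-resp-mod : ∀ {m a b} → m ∣ a - b → m ∣ b → m ∣ a
∣-resp-mod {m} {a} {b} p q = subst (m ∣_) (cancel a b) (∣m∣n⇒∣m+n p q)
  where
  cancel : ∀ a b → (a - b) + b ≡ a
  cancel = solve-∀

%-mod : ∀ d m .{{_ : NonZero m}} → + m ∣ + d - + (d % m)
%-mod d m = divides (+ q) (begin
  + d - + r                ≡⟨ cong (λ x → + x - + r) (m≡m%n+[m/n]*n d m) ⟩
  + (r ℕ.+ q ℕ.* m) - + r  ≡⟨ cong (_- + r) (trans (ℤ.pos-+ r _) (cong (λ s → + r + s) (ℤ.pos-* q m))) ⟩
  (+ r + + q * + m) - + r  ≡⟨ cancel (+ r) (+ q * + m) ⟩
  + q * + m                ∎)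
  where
  open ≡-Reasoning
  q r : ℕ
  q = d ℕ./ m
  r = d % m
  cancel : ∀ a b → (a + b) - a ≡ b
  cancel = solve-∀

-- Finite verification on residues.

-- The argument ν is the product δ ε because n = d e, so two residues determine everything. `C` is
-- the restriction that the hypothesis on n puts on residues of its divisors.
PairsVanish : Form → ℕ → Pred ℕ 0ℓ → Set
PairsVanish F m C = ∀ (x y : Fin m) → C (toℕ x) → C (toℕ y) → + m ∣ pair (+ toℕ x) (+ toℕ y)
  where
  pair : ℤ → ℤ → ℤ
  pair δ ε = ⟦ F ⟧at (δ * ε) δ + ⟦ F ⟧at (δ * ε) ε

SquaresVanish : Form → ℕ → Pred ℕ 0ℓ → Set
SquaresVanish F m C = ∀ (x : Fin m) → C (toℕ x) → + m ∣ ⟦ F ⟧at (+ toℕ x * + toℕ x) (+ toℕ x)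

vanish? : ∀ F m {C} → Decidable C → Dec (PairsVanish F m C × SquaresVanish F m C)
vanish? F m C? =
  all? (λ x → all? λ y → C? (toℕ x) →-dec (C? (toℕ y) →-dec (_ ∣? _))) ×-dec
  all? (λ x → C? (toℕ x) →-dec (_ ∣? _))

-- The finite check is the implicit `True` argument, settled by evaluation once the form and modulus
-- are concrete. Complementary divisors are then replaced by their residues.
∣⟦⟧σ-residues : ∀ F m .{{_ : NonZero m}} {C} (C? : Decidable C) {_ : True (vanish? F m C?)} →
                ∀ {n} → n ≥ 1 → (∀ {d} → d ℕ.∣ n → C (d % m)) → + m ∣ ⟦ F ⟧σ n
∣⟦⟧σ-residues F m {C} C? {check} {n} n≥1 C-div with toWitness check
... | pairs , squares = ∣⟦⟧σ F n≥1 pair square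
  where
  residue : ℕ → Fin m
  residue d = fromℕ< (m%n<n d m)
  toℕ-residue : ∀ d → toℕ (residue d) ≡ d % m
  toℕ-residue d = toℕ-fromℕ< (m%n<n d m)
  C-residue : ∀ {d} → d ℕ.∣ n → C (toℕ (residue d))
  C-residue {d} d∣n = subst C (sym (toℕ-residue d)) (C-div d∣n)
  residue-mod : ∀ d → + m ∣ + d - + toℕ (residue d)
  residue-mod d = subst (λ r → + m ∣ + d - + r) (sym (toℕ-residue d)) (%-mod d m)
  reduce : ∀ d e → d ℕ.* e ≡ n → + m ∣ + n - + toℕ (residue d) * + toℕ (residue e)
  reduce d e refl =
    subst (λ x → + m ∣ x - + toℕ (residue d) * + toℕ (residue e)) (sym (ℤ.pos-* d e))
      (*-cong-mod {a = + d} {+ toℕ (residue d)} (residue-mod d) (residue-mod e))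
  pair : ∀ d e → d ℕ.* e ≡ n → + m ∣ ⟦ F ⟧at (+ n) (+ d) + ⟦ F ⟧at (+ n) (+ e)
  pair d e de≡n = ∣-resp-mod
    (+-cong-mod {a = ⟦ F ⟧at (+ n) (+ d)}
      (⟦⟧at-cong-mod F (reduce d e de≡n) (residue-mod d))
      (⟦⟧at-cong-mod F (reduce d e de≡n) (residue-mod e)))
    (pairs (residue d) (residue e)
      (C-residue (ℕ.divides e (trans (sym de≡n) (ℕ.*-comm d e))))
      (C-residue (ℕ.divides d (sym de≡n))))
  square : ∀ d → d ℕ.* d ≡ n → + m ∣ ⟦ F ⟧at (+ n) (+ d)
  square d dd≡n = ∣-resp-mod
    (⟦⟧at-cong-mod F (reduce d d dd≡n) (residue-mod d))
    (squares (residue d) (C-residue (ℕ.divides d (sym dd≡n))))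

∤? : ∀ p → Decidable (p ∤_)
∤? p x = ¬? (p ℕ.∣? x)

-- Since p divides m, a p dividing the residue of d modulo m would divide d, hence n.
∣⟦⟧σ-∤ : ∀ F m p .{{_ : NonZero m}} {_ : True (p ℕ.∣? m)} {_ : True (vanish? F m (∤? p))} →
         ∀ {n} → n ≥ 1 → p ∤ n → + m ∣ ⟦ F ⟧σ n
∣⟦⟧σ-∤ F m p {p∣m} {check} n≥1 p∤n =
  ∣⟦⟧σ-residues F m (∤? p) {check} n≥1
    (λ d∣n p∣d%m → p∤n (ℕ.∣-trans (ℕ.∣n∣m%n⇒∣m (toWitness p∣m) p∣d%m) d∣n))

∣⟦⟧σ-all : ∀ F m .{{_ : NonZero m}} {_ : True (vanish? F m U?)} → ∀ {n} → n ≥ 1 → + m ∣ ⟦ F ⟧σ n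
∣⟦⟧σ-all F m {check} n≥1 = ∣⟦⟧σ-residues F m U? {check} n≥1 _

-- Divisor sums of an odd number times a power of 2.

odd-coprime-2 : ∀ i → Coprime (suc (i ℕ.* 2)) 2
odd-coprime-2 i {d} (d∣1+2i , d∣2) =
  ℕ.∣1⇒≡1 (ℕ.∣m+n∣m⇒∣n (subst (d ℕ.∣_) (ℕ.+-comm 1 (i ℕ.* 2)) d∣1+2i) (ℕ.∣n⇒∣m*n i d∣2))

-- An odd divisor is coprime to 2, so the factors 2 are stripped one at a time.
odd-divisor : ∀ i {m} a → suc (i ℕ.* 2) ℕ.∣ m ℕ.* 2 ℕ.^ a → suc (i ℕ.* 2) ℕ.∣ m
odd-divisor i {m} zero    d∣m   = subst (suc (i ℕ.* 2) ℕ.∣_) (ℕ.*-identityʳ m) d∣m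
odd-divisor i {m} (suc a) d∣m2ᵃ =
  odd-divisor i a (coprime-divisor (odd-coprime-2 i) (subst (suc (i ℕ.* 2) ℕ.∣_) (rotate m (2 ℕ.^ a)) d∣m2ᵃ))
  where
  rotate : ∀ m u → m ℕ.* (2 ℕ.* u) ≡ 2 ℕ.* (m ℕ.* u)
  rotate m u = trans (sym (ℕ.*-assoc m 2 u)) (trans (cong (ℕ._* u) (ℕ.*-comm m 2)) (ℕ.*-assoc 2 m u))

odd-positive : ∀ {m} → 2 ∤ m → m ≥ 1
odd-positive {zero}  2∤0 = contradiction (2 ℕ.∣0) 2∤0
odd-positive {suc _} _   = ℕ.s≤s ℕ.z≤n

-- With n = m 2ᵃ, the even divisors of 2n are the doubles of the divisors of n, and the odd ones are
-- the divisors of m.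
σ-double : ∀ k {m} a → 2 ∤ m →
  + σ[ k ] (m ℕ.* 2 ℕ.^ suc a) ≡ (+ 2) ^ k * + σ[ k ] (m ℕ.* 2 ℕ.^ a) + + σ[ k ] m
σ-double k {m} a 2∤m = begin
  + σ[ k ] (m ℕ.* 2 ℕ.^ suc a)
    ≡⟨ cong (λ x → + σ[ k ] x) 2n ⟩
  + σ[ k ] (n ℕ.* 2)
    -- The bound 2n + 2 exceeds 2n and is even, so the range splits by parity into two of length
    -- `suc n`.
    ≡⟨ σ-∑ k (ℕ.*-mono-≤ n≥1 (ℕ.s≤s (ℕ.z≤n {1}))) (ℕ.m<n⇒m<1+n (ℕ.n<1+n _)) ⟩
  ∑ (suc n ℕ.* 2) (term (n ℕ.* 2))
    ≡⟨ ∑-parity (suc n) (term (n ℕ.* 2)) ⟩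
  ∑ (suc n) (λ i → term (n ℕ.* 2) (i ℕ.* 2)) + ∑ (suc n) (λ i → term (n ℕ.* 2) (suc (i ℕ.* 2)))
    ≡⟨ cong₂ _+_ (trans (∑-cong (suc n) even-term) (*-distribˡ-∑ (suc n) ((+ 2) ^ k) (term n)))
                 (∑-cong (suc n) odd-term) ⟩
  (+ 2) ^ k * ∑ (suc n) (term n) + ∑ (suc n) (λ i → term m (suc (i ℕ.* 2)))
    ≡⟨ cong₂ (λ s t → (+ 2) ^ k * s + t) (sym (σ-∑ k n≥1 (ℕ.n<1+n n))) (sym σm) ⟩
  (+ 2) ^ k * + σ[ k ] n + + σ[ k ] m ∎
  where
  open ≡-Reasoning
  n : ℕ
  n = m ℕ.* 2 ℕ.^ a
  m≤n : m ℕ.≤ n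
  m≤n = ℕ.m≤m*n m (2 ℕ.^ a) {{ℕ.m^n≢0 2 a}}
  n≥1 : n ≥ 1
  n≥1 = ℕ.≤-trans (odd-positive 2∤m) m≤n
  2n : m ℕ.* 2 ℕ.^ suc a ≡ n ℕ.* 2
  2n = trans (cong (m ℕ.*_) (ℕ.*-comm 2 (2 ℕ.^ a))) (sym (ℕ.*-assoc m (2 ℕ.^ a) 2))
  term : ℕ → ℕ → ℤ
  term x d = (+ d) ^ k when (d ℕ.∣? x)
  pow-* : ∀ j x y → (x * y) ^ j ≡ y ^ j * x ^ j
  pow-* zero    x y = refl
  pow-* (suc j) x y = trans (cong (x * y *_) (pow-* j x y)) (interchange x y (y ^ j) (x ^ j))
    where
    interchange : ∀ x y v u → x * y * (v * u) ≡ y * v * (x * u)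
    interchange = solve-∀
  even-term : ∀ i → term (n ℕ.* 2) (i ℕ.* 2) ≡ (+ 2) ^ k * term n i
  even-term i = begin
    term (n ℕ.* 2) (i ℕ.* 2)
      ≡⟨ when-cong ((+ (i ℕ.* 2)) ^ k) (i ℕ.* 2 ℕ.∣? n ℕ.* 2) (i ℕ.∣? n) (ℕ.*-cancelʳ-∣ 2) (ℕ.*-monoˡ-∣ 2) ⟩
    (+ (i ℕ.* 2)) ^ k when (i ℕ.∣? n)
      ≡⟨ cong (_when (i ℕ.∣? n)) (trans (cong (_^ k) (ℤ.pos-* i 2)) (pow-* k (+ i) (+ 2))) ⟩
    (+ 2) ^ k * (+ i) ^ k when (i ℕ.∣? n)
      ≡⟨ when-* ((+ 2) ^ k) ((+ i) ^ k) (i ℕ.∣? n) ⟩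
    (+ 2) ^ k * term n i ∎
  odd-term : ∀ i → term (n ℕ.* 2) (suc (i ℕ.* 2)) ≡ term m (suc (i ℕ.* 2))
  odd-term i = when-cong ((+ d) ^ k) (d ℕ.∣? n ℕ.* 2) (d ℕ.∣? m)
    (odd-divisor i (suc a) ∘ subst (d ℕ.∣_) (sym 2n))
    (λ d∣m → ℕ.∣m⇒∣m*n 2 (ℕ.∣m⇒∣m*n (2 ℕ.^ a) d∣m))
    where
    d : ℕ
    d = suc (i ℕ.* 2)
  σm : + σ[ k ] m ≡ ∑ (suc n) (λ i → term m (suc (i ℕ.* 2)))
  σm = begin
    + σ[ k ] m
      -- The range used for 2n is taken again, so that the odd indices match; the even ones vanish
      -- because m is odd.
      ≡⟨ σ-∑ k (odd-positive 2∤m) (ℕ.s≤s (ℕ.≤-trans m≤n (ℕ.≤-trans (ℕ.m≤m*n n 2) (ℕ.n≤1+n _)))) ⟩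
    ∑ (suc n ℕ.* 2) (term m)
      ≡⟨ ∑-parity (suc n) (term m) ⟩
    ∑ (suc n) (λ i → term m (i ℕ.* 2)) + ∑ (suc n) (λ i → term m (suc (i ℕ.* 2)))
      ≡⟨ cong (_+ ∑ (suc n) (λ i → term m (suc (i ℕ.* 2))))
           (∑-zero (suc n) (λ i → when-no ((+ (i ℕ.* 2)) ^ k)
             (i ℕ.* 2 ℕ.∣? m) (2∤m ∘ ℕ.∣-trans (ℕ.n∣m*n i)))) ⟩
    0ℤ + ∑ (suc n) (λ i → term m (suc (i ℕ.* 2)))
      ≡⟨ ℤ.+-identityˡ _ ⟩
    ∑ (suc n) (λ i → term m (suc (i ℕ.* 2))) ∎

-- The first factor is σ(2ᵃ) = 2ᵃ⁺¹ - 1; it arises by iterating `σ-double`, without multiplicativity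
-- of σ.
σ-*-2^ : ∀ {m} a → 2 ∤ m → + σ (m ℕ.* 2 ℕ.^ a) ≡ (+ 2 * + (2 ℕ.^ a) - + 1) * + σ m
σ-*-2^ {m} zero    2∤m = trans (cong (λ x → + σ x) (ℕ.*-identityʳ m)) (sym (ℤ.*-identityˡ (+ σ m)))
σ-*-2^ {m} (suc a) 2∤m = begin
  + σ (m ℕ.* 2 ℕ.^ suc a)                                      ≡⟨ σ-double 1 a 2∤m ⟩
  (+ 2) ^ 1 * + σ (m ℕ.* 2 ℕ.^ a) + + σ m                      ≡⟨ cong (λ s → + 2 * s + + σ m) (σ-*-2^ a 2∤m) ⟩
  + 2 * ((+ 2 * + (2 ℕ.^ a) - + 1) * + σ m) + + σ m            ≡⟨ collect (+ (2 ℕ.^ a)) (+ σ m) ⟩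
  (+ 2 * (+ 2 * + (2 ℕ.^ a)) - + 1) * + σ m                    ≡⟨ cong (λ x → (+ 2 * x - + 1) * + σ m) (ℤ.pos-* 2 (2 ℕ.^ a)) ⟨
  (+ 2 * + (2 ℕ.^ suc a) - + 1) * + σ m                        ∎
  where
  open ≡-Reasoning
  collect : ∀ u s → + 2 * ((+ 2 * u - + 1) * s) + s ≡ (+ 2 * (+ 2 * u) - + 1) * s
  collect = solve-∀

odd-part : ∀ {n} → n ≥ 1 → ∃₂ λ m a → 2 ∤ m × n ≡ m ℕ.* 2 ℕ.^ a
odd-part {n} n≥1 = go n n≥1 (<-wellFounded n)
  where
  go : ∀ n → n ≥ 1 → Acc _<_ n → ∃₂ λ m a → 2 ∤ m × n ≡ m ℕ.* 2 ℕ.^ a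
  go n n≥1 (acc rs) with 2 ℕ.∣? n
  ... | no 2∤n = n , 0 , 2∤n , sym (ℕ.*-identityʳ n)
  ... | yes (ℕ.divides q@(suc _) refl) with go q (ℕ.s≤s ℕ.z≤n) (rs (ℕ.m<m*n q 2 (ℕ.s<s ℕ.z<s)))
  ...   | m , a , 2∤m , q≡ = m , suc a , 2∤m , (begin
          q ℕ.* 2                   ≡⟨ cong (ℕ._* 2) q≡ ⟩
          m ℕ.* 2 ℕ.^ a ℕ.* 2       ≡⟨ ℕ.*-assoc m (2 ℕ.^ a) 2 ⟩
          m ℕ.* (2 ℕ.^ a ℕ.* 2)     ≡⟨ cong (m ℕ.*_) (ℕ.*-comm (2 ℕ.^ a) 2) ⟩
          m ℕ.* 2 ℕ.^ suc a         ∎)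
    where open ≡-Reasoning
  go n n≥1 (acc rs) | yes (ℕ.divides zero refl) = contradiction n≥1 λ ()

-- The forms of the congruences, and (iv) modulo 32.

-- Each form is the left side minus the right side; (vi) has the same two sides as (ii) and shares
-- `form-ii`.
form-i form-ii form-iii form-iv form-v form-vii : Form
form-i   = (+ 6 , 1 , 1) ∷ (- + 5 , 0 , 1) ∷ (- + 1 , 0 , 3) ∷ []
form-ii  = (+ 1 , 0 , 1) ∷ (+ 2 , 1 , 3) ∷ (- + 3 , 0 , 5) ∷ []
form-iii = (+ 1 , 1 , 1) ∷ (+ 5 , 1 , 7) ∷ (- + 6 , 2 , 5) ∷ []
form-iv  = (+ 20 , 0 , 7) ∷ (+ 11 , 0 , 9) ∷ (- + 1 , 0 , 1) ∷ (- + 30 , 1 , 7) ∷ []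
form-v   = (+ 5 , 0 , 1) ∷ (+ 6 , 1 , 7) ∷ (- + 11 , 0 , 9) ∷ []
form-vii = (+ 1 , 0 , 1) ∷ (+ 30 , 1 , 7) ∷ (- + 20 , 0 , 7) ∷ (- + 11 , 0 , 9) ∷ []

-- For n = 2w·m with m odd and w a power of 2, modulo 32 the higher power sums of n
-- are those of m, and σ(n) = (4w − 1) σ(m); so form-iv at n becomes
-- constantPart + 2w · linearPart at m.
constantPart linearPart : Form
constantPart = (+ 20 , 0 , 7) ∷ (+ 11 , 0 , 9) ∷ (+ 1 , 0 , 1) ∷ []
linearPart   = (- + 2 , 0 , 1) ∷ (- + 30 , 1 , 7) ∷ []

-- For odd n the residue check applies. For even n, `σ-double` leaves two forms at m and the terms
-- `t 7` and `t 9`, which vanish modulo 32 because 2⁷ and 2⁹ do.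
form-iv-mod-32 : ∀ {n} → n ≥ 1 → + 32 ∣ ⟦ form-iv ⟧σ n
form-iv-mod-32 {n} n≥1 with odd-part n≥1
... | m , zero  , 2∤m , n≡ = ∣⟦⟧σ-∤ form-iv 32 2 n≥1 (subst (2 ∤_) (sym (trans n≡ (ℕ.*-identityʳ m))) 2∤m)
... | m , suc b , 2∤m , refl =
  subst (+ 32 ∣_) (sym expand)
    (∣m∣n⇒∣m+n
      (∣m∣n⇒∣m+n (∣⟦⟧σ-∤ constantPart 32 2 m≥1 2∤m)
                 -- `w` may be 1, so only the factor 2 is certain; 16 dividing `L` then suffices.
                 (subst (+ 32 ∣_) (sym (ℤ.*-assoc (+ 2) (+ w) L))
                   (*-monoʳ-∣ (+ 2) (∣n⇒∣m*n (+ w) (∣⟦⟧σ-∤ linearPart 16 2 m≥1 2∤m)))))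
      (∣m∣n⇒∣m+n (∣n⇒∣m*n (+ 20 - + 30 * + n) (high 7 (from-yes (+ 32 ∣? (+ 2) ^ 7))))
                 (∣n⇒∣m*n (+ 11) (high 9 (from-yes (+ 32 ∣? (+ 2) ^ 9))))))
  where
  w : ℕ
  w = 2 ℕ.^ b
  L : ℤ
  L = ⟦ linearPart ⟧σ m
  m≥1 : m ≥ 1
  m≥1 = odd-positive 2∤m
  t : ℕ → ℤ
  t k = (+ 2) ^ k * + σ[ k ] (m ℕ.* w)
  high : ∀ k → + 32 ∣ (+ 2) ^ k → + 32 ∣ t k
  high k = ∣m⇒∣m*n (+ σ[ k ] (m ℕ.* w))
  +n : + n ≡ + m * (+ 2 * + w)
  +n = trans (ℤ.pos-* m (2 ℕ.* w)) (cong (+ m *_) (ℤ.pos-* 2 w))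
  -- The factors `+ 1` and trailing `+ 0` are what zeroth powers and the empty form unfold to, so
  -- the identity fits the evaluated forms definitionally.
  identity : ∀ m w s₁ s₇ s₉ t₇ t₉ →
    + 20 * + 1 * (t₇ + s₇) + (+ 11 * + 1 * (t₉ + s₉) + (- + 1 * + 1 * ((+ 2 * (+ 2 * w) - + 1) * s₁)
      + (- + 30 * (m * (+ 2 * w) * + 1) * (t₇ + s₇) + + 0)))
    ≡ (+ 20 * + 1 * s₇ + (+ 11 * + 1 * s₉ + (+ 1 * + 1 * s₁ + + 0)))
      + + 2 * w * (- + 2 * + 1 * s₁ + (- + 30 * (m * + 1) * s₇ + + 0))
      + ((+ 20 - + 30 * (m * (+ 2 * w))) * t₇ + + 11 * t₉)
  identity = solve-∀
  substituted : ∀ (m w t₇ t₉ : ℤ) (s s′ : ℕ → ℤ) {ν} → ν ≡ m * (+ 2 * w) →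
    s′ 1 ≡ (+ 2 * (+ 2 * w) - + 1) * s 1 → s′ 7 ≡ t₇ + s 7 → s′ 9 ≡ t₉ + s 9 →
    ⟦ form-iv ⟧ ν s′ ≡
    ⟦ constantPart ⟧ m s + + 2 * w * ⟦ linearPart ⟧ m s + ((+ 20 - + 30 * ν) * t₇ + + 11 * t₉)
  substituted m w t₇ t₉ s s′ refl s′₁ s′₇ s′₉ rewrite s′₁ | s′₇ | s′₉ =
    identity m w (s 1) (s 7) (s 9) t₇ t₉
  σ₁ : + σ n ≡ (+ 2 * (+ 2 * + w) - + 1) * + σ m
  σ₁ = trans (σ-*-2^ (suc b) 2∤m) (cong (λ x → (+ 2 * x - + 1) * + σ m) (ℤ.pos-* 2 w))
  expand : ⟦ form-iv ⟧σ n ≡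
           ⟦ constantPart ⟧σ m + + 2 * + w * L + ((+ 20 - + 30 * + n) * t 7 + + 11 * t 9)
  expand = substituted (+ m) (+ w) (t 7) (t 9) (λ k → + σ[ k ] m) (λ k → + σ[ k ] n)
             +n σ₁ (σ-double 7 b 2∤m) (σ-double 9 b 2∤m)

-- Assembling the moduli from prime powers.

gcd≡1⇒∤ : ∀ {n} p {q} {_ : True (p ℕ.∣? q)} → p ≢ 1 → gcd n q ≡ 1 → p ∤ n
gcd≡1⇒∤ p {q} {p∣q} p≢1 coprime p∣n =
  p≢1 (ℕ.∣1⇒≡1 (subst (p ℕ.∣_) coprime (gcd-greatest p∣n (toWitness p∣q))))

corollary2p12 : (n : ℕ) → n ≥ 1 →
    (gcd n 6 ≡ 1 →
      (+ 6 * + n - + 5) * + σ n ≡ + σ[ 3 ] n [mod + 24 ])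
  × (2 ∤ n →
      + σ n + + 2 * + n * + σ[ 3 ] n ≡ + 3 * + σ[ 5 ] n [mod + 16 ])
  × (gcd n 42 ≡ 1 →
      + n * + σ n + + 5 * + n * + σ[ 7 ] n ≡ + 6 * (+ n) ^ 2 * + σ[ 5 ] n [mod (+ 2) ^ 3 * (+ 3) ^ 2 * + 7 ])
  × (+ 20 * + σ[ 7 ] n + + 11 * + σ[ 9 ] n ≡ + σ n + + 30 * + n * + σ[ 7 ] n [mod (+ 2) ^ 5 * + 3 * + 5 ])
  × (2 ∤ n →
      + 5 * + σ n + + 6 * + n * + σ[ 7 ] n ≡ + 11 * + σ[ 9 ] n [mod (+ 2) ^ 5 ])
  × (gcd n 10 ≡ 1 →
      + σ n + + 2 * + n * + σ[ 3 ] n ≡ + 3 * + σ[ 5 ] n [mod (+ 2) ^ 4 * + 5 ])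
  × (gcd n 30 ≡ 1 →
      + σ n + + 10 * (+ 3 * + n - + 2) * + σ[ 7 ] n ≡ + 11 * + σ[ 9 ] n [mod (+ 2) ^ 3 * + 3 * + 5 ])
corollary2p12 n n≥1 = i , ii , iii , iv , v , vi , vii
  where
  s : ℕ → ℤ
  s k = + σ[ k ] n

  id-i : ∀ n s₁ s₃ →
    + 6 * (n * + 1) * s₁ + (- + 5 * + 1 * s₁ + (- + 1 * + 1 * s₃ + + 0))
    ≡ (+ 6 * n - + 5) * s₁ - s₃
  id-i = solve-∀
  id-ii : ∀ n s₁ s₃ s₅ →
    + 1 * + 1 * s₁ + (+ 2 * (n * + 1) * s₃ + (- + 3 * + 1 * s₅ + + 0))
    ≡ s₁ + + 2 * n * s₃ - + 3 * s₅
  id-ii = solve-∀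
  id-iii : ∀ n s₁ s₅ s₇ →
    + 1 * (n * + 1) * s₁ + (+ 5 * (n * + 1) * s₇ + (- + 6 * (n * (n * + 1)) * s₅ + + 0))
    ≡ n * s₁ + + 5 * n * s₇ - + 6 * (n * (n * + 1)) * s₅
  id-iii = solve-∀
  id-iv : ∀ n s₁ s₇ s₉ →
    + 20 * + 1 * s₇ + (+ 11 * + 1 * s₉ + (- + 1 * + 1 * s₁ + (- + 30 * (n * + 1) * s₇ + + 0)))
    ≡ + 20 * s₇ + + 11 * s₉ - (s₁ + + 30 * n * s₇)
  id-iv = solve-∀
  id-v : ∀ n s₁ s₇ s₉ →
    + 5 * + 1 * s₁ + (+ 6 * (n * + 1) * s₇ + (- + 11 * + 1 * s₉ + + 0))
    ≡ + 5 * s₁ + + 6 * n * s₇ - + 11 * s₉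
  id-v = solve-∀
  id-vii : ∀ n s₁ s₇ s₉ →
    + 1 * + 1 * s₁ + (+ 30 * (n * + 1) * s₇ + (- + 20 * + 1 * s₇ + (- + 11 * + 1 * s₉ + + 0)))
    ≡ s₁ + + 10 * (+ 3 * n - + 2) * s₇ - + 11 * s₉
  id-vii = solve-∀

  i : gcd n 6 ≡ 1 → _
  -- The goal computes to divisibility of an absolute value in ℕ, and `lcm 8 3` evaluates to 24, so
  -- the prime powers are treated separately; the composite moduli below work alike.
  i c = subst (λ x → 24 ℕ.∣ ∣ x ∣) (id-i (+ n) (s 1) (s 3))
    (lcm-least (∣⇒∣ᵤ (∣⟦⟧σ-∤ form-i 8 2 n≥1 (gcd≡1⇒∤ 2 (λ ()) c)))
               (∣⇒∣ᵤ (∣⟦⟧σ-∤ form-i 3 3 n≥1 (gcd≡1⇒∤ 3 (λ ()) c))))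

  ii : 2 ∤ n → _
  ii 2∤n = subst (λ x → 16 ℕ.∣ ∣ x ∣) (id-ii (+ n) (s 1) (s 3) (s 5)) (∣⇒∣ᵤ (∣⟦⟧σ-∤ form-ii 16 2 n≥1 2∤n))

  iii : gcd n 42 ≡ 1 → _
  iii c = subst (λ x → 504 ℕ.∣ ∣ x ∣) (id-iii (+ n) (s 1) (s 5) (s 7))
    (lcm-least (∣⇒∣ᵤ (∣⟦⟧σ-∤ form-iii 8 2 n≥1 (gcd≡1⇒∤ 2 (λ ()) c)))
    (lcm-least (∣⇒∣ᵤ (∣⟦⟧σ-∤ form-iii 9 3 n≥1 (gcd≡1⇒∤ 3 (λ ()) c)))
               (∣⇒∣ᵤ (∣⟦⟧σ-∤ form-iii 7 7 n≥1 (gcd≡1⇒∤ 7 (λ ()) c)))))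

  iv : _
  iv = subst (λ x → 480 ℕ.∣ ∣ x ∣) (id-iv (+ n) (s 1) (s 7) (s 9))
    (lcm-least (∣⇒∣ᵤ (form-iv-mod-32 n≥1))
    (lcm-least (∣⇒∣ᵤ (∣⟦⟧σ-all form-iv 3 n≥1)) (∣⇒∣ᵤ (∣⟦⟧σ-all form-iv 5 n≥1))))

  v : 2 ∤ n → _
  v 2∤n = subst (λ x → 32 ℕ.∣ ∣ x ∣) (id-v (+ n) (s 1) (s 7) (s 9)) (∣⇒∣ᵤ (∣⟦⟧σ-∤ form-v 32 2 n≥1 2∤n))

  vi : gcd n 10 ≡ 1 → _
  vi c = subst (λ x → 80 ℕ.∣ ∣ x ∣) (id-ii (+ n) (s 1) (s 3) (s 5))
    (lcm-least (∣⇒∣ᵤ (∣⟦⟧σ-∤ form-ii 16 2 n≥1 (gcd≡1⇒∤ 2 (λ ()) c)))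
               (∣⇒∣ᵤ (∣⟦⟧σ-∤ form-ii 5 5 n≥1 (gcd≡1⇒∤ 5 (λ ()) c))))

  vii : gcd n 30 ≡ 1 → _
  vii c = subst (λ x → 120 ℕ.∣ ∣ x ∣) (id-vii (+ n) (s 1) (s 7) (s 9))
    (lcm-least (∣⇒∣ᵤ (∣⟦⟧σ-∤ form-vii 8 2 n≥1 (gcd≡1⇒∤ 2 (λ ()) c)))
    (lcm-least (∣⇒∣ᵤ (∣⟦⟧σ-∤ form-vii 3 3 n≥1 (gcd≡1⇒∤ 3 (λ ()) c)))
               (∣⇒∣ᵤ (∣⟦⟧σ-∤ form-vii 5 5 n≥1 (gcd≡1⇒∤ 5 (λ ()) c)))))
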